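{- Let $\mathbf R$ be a partially ordered set with maximum $1$, let $P\subseteq R$ with $1\in P$, and let $\mathbf P$ be the induced poset on $P$. If $a\in R$ and there exists a smallest element $c\in P$ such that $a\leq c$, then $a$ is a $P$-non-generator in $\mathbf R$ if and only if $c$ is a non-generator in $\mathbf P$.
   Context: Let $\mathbf R$ be a poset with maximum $1$ and $P\subseteq R$ with $1\in P$. No further assumption is made on the induced poset $\mathbf P$ (for example, it need not be a semilattice). A subset $Y\subseteq R$ $P$-generates $1$ if there is no $b\in P$ such that $b<1$ and $y\leq b$ for every $y\in Y$. An element $a\in R$ is a $P$-non-generator in $\mathbf R$ if, for every $e\in R$, if $\{a,e\}$ $P$-generates $1$, then $\{e\}$ $P$-generates $1$. In the poset $\mathbf P$ (with maximum $1$), for $c,d\in P$, "$c\vee d=1$" means that there is no $p\in P$ such that $p<1$, $c\leq p$ and $d\leq p$; an element $c\in P$ is a non-generator in $\mathbf P$ if, for every $d\in P$, $c\vee d=1$ implies $d=1$. -}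

module Defs where

open import Data.Product using (∃; ∃-syntax; _×_; proj₁)
open import Data.Sum using (_⊎_)
open import Level using (Level)
open import Relation.Binary.Bundles using (Poset)
import Relation.Binary.Construct.On as On
import Relation.Binary.Properties.Poset as PosetProperties
open import Relation.Nullary using (¬_)
open import Relation.Unary using (Pred; _∈_)

private
  variable
    r ℓ₁ ℓ₂ p s : Level

-- The strict order _<_ used below is the library's: x ≤ y together with ¬ x ≈ y.

induced : (𝐑 : Poset r ℓ₁ ℓ₂) → Pred (Poset.Carrier 𝐑) p → Poset _ ℓ₁ ℓ₂
induced 𝐑 P = On.poset 𝐑 (proj₁ {B = P})

module _ (𝐑 : Poset r ℓ₁ ℓ₂) where
  open Poset 𝐑
  open PosetProperties 𝐑 using (_<_)

  -- Finite subsets are closed under the equality _≈_ of the poset.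
  Singleton : Carrier → Pred Carrier ℓ₁
  Singleton e x = x ≈ e

  Pair : Carrier → Carrier → Pred Carrier ℓ₁
  Pair a e x = x ≈ a ⊎ x ≈ e

  IsSmallest : Pred Carrier s → Carrier → Set _
  IsSmallest S m = m ∈ S × (∀ x → x ∈ S → m ≤ x)

  -- In the following definitions 𝟙 is meant to be the maximum of 𝐑.

  Generates : Carrier → Pred Carrier p → Pred Carrier s → Set _
  Generates 𝟙 P Y = ¬ (∃[ b ] b ∈ P × b < 𝟙 × (∀ y → y ∈ Y → y ≤ b))

  RelativeNonGenerator : Carrier → Pred Carrier p → Carrier → Set _
  RelativeNonGenerator 𝟙 P a =
    ∀ e → Generates 𝟙 P (Pair a e) → Generates 𝟙 P (Singleton e)

  -- "c ∨ d = 1"; the join need not exist as an operation.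
  JoinIsTop : Carrier → Carrier → Carrier → Set _
  JoinIsTop 𝟙 c d = ¬ (∃[ q ] q < 𝟙 × c ≤ q × d ≤ q)

  NonGenerator : Carrier → Carrier → Set _
  NonGenerator 𝟙 c = ∀ d → JoinIsTop 𝟙 c d → d ≈ 𝟙

{-# OPTIONS --safe #-}
module Submission where

open import Defs
open import Axiom.ExcludedMiddle using (ExcludedMiddle)
open import Data.Product using (_,_; proj₁)
open import Data.Sum using (inj₁; inj₂)
open import Function.Bundles using (_⇔_; mk⇔)
open import Level using (Level)
open import Relation.Binary.Bundles using (Poset)
open import Relation.Binary.Definitions using (Maximum)
open import Relation.Nullary.Decidable using (decidable-stable)
open import Relation.Unary using (Pred; _∈_)

-- Since `c` is the least element of `P` above `a`, the elements `a` and `c` have the same upper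
-- bounds in `P`. So for `d` in `P`, the pair of `a` and `d` P-generates `𝟙` exactly when
-- `c ∨ d = 𝟙` in `𝐏`. An `e` outside `P` is handled by passing to a bound of it in `P`.

lemma3p1 : ∀ {r ℓ₁ ℓ₂ p : Level} → ExcludedMiddle ℓ₁ →
    (𝐑 : Poset r ℓ₁ ℓ₂) → let open Poset 𝐑 in
    (𝟙 : Carrier) → Maximum _≤_ 𝟙 →
    (P : Pred Carrier p) (𝟙∈P : 𝟙 ∈ P) → let 𝐏 = induced 𝐑 P in
    (a : Carrier) (c : Poset.Carrier 𝐏) →
    IsSmallest 𝐏 (λ x → a ≤ proj₁ x) c →
    RelativeNonGenerator 𝐑 𝟙 P a ⇔ NonGenerator 𝐏 (𝟙 , 𝟙∈P) c
lemma3p1 em 𝐑 𝟙 max P 𝟙∈P a c (a≤c , c-least) = mk⇔ to from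
  where
  open Poset 𝐑
  𝐏 = induced 𝐑 P

  -- If d < 𝟙, then d itself witnesses that {d} does not P-generate 𝟙.
  to : RelativeNonGenerator 𝐑 𝟙 P a → NonGenerator 𝐏 (𝟙 , 𝟙∈P) c
  -- Generation is a negative statement, so it only refutes `d ≉ 𝟙`; excluded middle turns this into
  -- `d ≈ 𝟙`.
  to a-non (d , d∈P) c∨d=𝟙 = decidable-stable em λ d≉𝟙 →
    a-non d
      (λ (b , b∈P , b<𝟙 , bound) →
        c∨d=𝟙 ((b , b∈P) , b<𝟙
              , c-least (b , b∈P) (bound a (inj₁ Eq.refl))
              , bound d (inj₂ Eq.refl)))
      (d , d∈P , (max d , d≉𝟙) , λ _ → reflexive)

  -- A bound b < 𝟙 of {e} in P would satisfy c ∨ b = 𝟙.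
  from : NonGenerator 𝐏 (𝟙 , 𝟙∈P) c → RelativeNonGenerator 𝐑 𝟙 P a
  from c-non e ae-gen (b , b∈P , (_ , b≉𝟙) , bound) =
    b≉𝟙 (c-non (b , b∈P) λ ((q , q∈P) , q<𝟙 , c≤q , b≤q) →
      -- `q` bounds the pair, as `a ≤ c ≤ q` and `e ≤ b ≤ q`.
      ae-gen (q , q∈P , q<𝟙 , λ where
        y (inj₁ y≈a) → trans (reflexive y≈a) (trans a≤c c≤q)
        y (inj₂ y≈e) → trans (bound y y≈e) b≤q))
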